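{- Let $D$ be a digraph such that every proper induced subdigraph of $D$ satisfies the BE-property. If $\alpha(D) \geq \frac{|V(D)|}{2}$, then $D$ satisfies the BE-property.
   Context: All digraphs are finite, without loops and without multiple edges (a pair of opposite edges $uv$, $vu$ is allowed). Two vertices $u,v$ are adjacent if $uv$ or $vu$ is an edge. A stable set is a set of pairwise non-adjacent vertices; $\alpha(D)$ is the maximum cardinality of a stable set of $D$, and a maximum stable set is one of cardinality $\alpha(D)$. A path is a directed path $v_1v_2\dots v_k$ with distinct vertices ($k\ge 1$; a single vertex is a path); it starts at $v_1$ and ends at $v_k$. A path partition of $D$ is a collection $\mathcal{P}$ of paths of $D$ such that every vertex of $D$ belongs to exactly one path of $\mathcal{P}$. A stable set $S$ and a path partition $\mathcal{P}$ are orthogonal if $|V(P)\cap S|=1$ for every $P\in\mathcal{P}$. An $S_{BE}$-path partition of $D$ is a path partition $\mathcal{P}$ such that $\mathcal{P}$ and $S$ are orthogonal and every vertex of $S$ starts or ends a path of $\mathcal{P}$. A digraph $D$ satisfies the BE-property if for every maximum stable set $S$ of $D$ there exists an $S_{BE}$-path partition of $D$. -}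

module Defs where

open import Data.Fin using (Fin)
open import Data.Fin.Properties using (all?)
open import Data.Fin.Subset using (Subset; _∈_; _⊆_; _∩_; ⊥; ⁅_⁆; ⋃; ∣_∣)
open import Data.Fin.Subset.Properties using (_∈?_; _⊆?_; anySubset?; ∉⊥; ⊥⊆; ∣⊥∣≡0; ∣p∣≤n)
open import Data.List using (List; map; filter; upTo; length; lookup)
open import Data.List.Extrema.Nat using (max; xs≤max; argmax-all)
open import Data.List.Membership.Propositional.Properties using (∈-upTo⁺; ∈-filter⁺)
open import Data.List.NonEmpty using (List⁺; toList; head; last)
import Data.List.Relation.Unary.All as All
open All using (All)
open import Data.List.Relation.Unary.All.Properties using (all-filter)
open import Data.List.Relation.Unary.Any using (Any)
open import Data.List.Relation.Unary.Linked using (Linked)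
open import Data.List.Relation.Unary.Unique.Propositional using (Unique)
open import Data.Nat using (ℕ; _≤_; _≟_; s≤s)
open import Data.Product using (∃; ∃!; _×_; _,_; proj₁; proj₂)
open import Data.Sum using (_⊎_)
open import Function using (id)
open import Level using (0ℓ)
open import Relation.Binary using (Rel; Decidable; Irreflexive)
open import Relation.Binary.PropositionalEquality using (_≡_; refl)
open import Relation.Nullary using (Dec; ¬_; ¬?)
open import Relation.Nullary.Decidable using (_×-dec_; _⊎-dec_; _→-dec_)
open import Data.Empty using (⊥-elim)

-- The vertex set is an arbitrary subset of an ambient Fin N, so that an induced
-- subdigraph is again a Digraph N.  Edges form a relation, whose proofs are never
-- compared or counted, so there are no parallel edges.
record Digraph (N : ℕ) : Set₁ where
  field
    V      : Subset N
    Edge   : Rel (Fin N) 0ℓ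
    edge?  : Decidable Edge
    edge∈V : ∀ {u v} → Edge u v → u ∈ V × v ∈ V
    irrefl : Irreflexive _≡_ Edge

  Adjacent : Rel (Fin N) 0ℓ
  Adjacent u v = Edge u v ⊎ Edge v u

  adjacent? : Decidable Adjacent
  adjacent? u v = edge? u v ⊎-dec edge? v u

open Digraph public

induced : ∀ {N} (D : Digraph N) (U : Subset N) → U ⊆ V D → Digraph N
induced D U _ = record
  { V      = U
  ; Edge   = λ u v → Edge D u v × u ∈ U × v ∈ U
  ; edge?  = λ u v → edge? D u v ×-dec (u ∈? U) ×-dec (v ∈? U)
  ; edge∈V = proj₂
  ; irrefl = λ u≡v uv → irrefl D u≡v (proj₁ uv)
  }

module _ {N : ℕ} (D : Digraph N) where

  -- Distinctness of u and v need not be assumed: no vertex is adjacent to itself.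
  Stable : Subset N → Set
  Stable S = S ⊆ V D × (∀ u v → u ∈ S → v ∈ S → ¬ Adjacent D u v)

  stable? : (S : Subset N) → Dec (Stable S)
  stable? S = (S ⊆? V D) ×-dec
    all? (λ u → all? (λ v → (u ∈? S) →-dec ((v ∈? S) →-dec ¬? (adjacent? D u v))))

  StableOfSize : ℕ → Set
  StableOfSize k = ∃ λ S → Stable S × ∣ S ∣ ≡ k

  stableOfSize? : (k : ℕ) → Dec (StableOfSize k)
  stableOfSize? k = anySubset? (λ S → stable? S ×-dec (∣ S ∣ ≟ k))

  -- The default value 0 of max is the size of the empty stable set.
  α : ℕ
  α = max 0 (filter stableOfSize? (upTo (ℕ.suc N)))

  α-attained : StableOfSize α
  α-attained = argmax-all id {P = StableOfSize}
    (⊥ , (⊥⊆ , λ u v u∈⊥ _ _ → ⊥-elim (∉⊥ u∈⊥)) , ∣⊥∣≡0 N)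
    (all-filter stableOfSize? (upTo (ℕ.suc N)))

  ∣stable∣≤α : ∀ S → Stable S → ∣ S ∣ ≤ α
  ∣stable∣≤α S stable = All.lookup (xs≤max 0 (filter stableOfSize? (upTo (ℕ.suc N))))
    (∈-filter⁺ stableOfSize? (∈-upTo⁺ (s≤s (∣p∣≤n S))) (S , stable , refl))

  MaximumStable : Subset N → Set
  MaximumStable S = Stable S × ∣ S ∣ ≡ α

  record Path : Set where
    field
      vertices : List⁺ (Fin N)
      inV      : All (_∈ V D) (toList vertices)
      distinct : Unique (toList vertices)
      linked   : Linked (Edge D) (toList vertices)

    start end : Fin N
    start = head vertices
    end   = last vertices

    vertexSet : Subset N
    vertexSet = ⋃ (map ⁅_⁆ (toList vertices))

  open Path

  -- Quantifying over positions also rules out listing the same path twice.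
  PathPartition : List Path → Set
  PathPartition 𝒫 =
    ∀ v → v ∈ V D → ∃! _≡_ λ (i : Fin (length 𝒫)) → v ∈ vertexSet (lookup 𝒫 i)

  Orthogonal : Subset N → List Path → Set
  Orthogonal S 𝒫 = All (λ P → ∣ vertexSet P ∩ S ∣ ≡ 1) 𝒫

  BEPathPartition : Subset N → List Path → Set
  BEPathPartition S 𝒫 =
    PathPartition 𝒫 ×
    Orthogonal S 𝒫 ×
    (∀ v → v ∈ S → Any (λ P → start P ≡ v ⊎ end P ≡ v) 𝒫)

  BEProperty : Set
  BEProperty = ∀ S → MaximumStable S → ∃ λ 𝒫 → BEPathPartition S 𝒫

{-# OPTIONS --safe #-}

-- Let S be a maximum stable set.  Call W semistable if no vertex of W ∩ S is
-- adjacent to one of W ─ S, and let U = W △ S.  Suppose that some semistable W with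
-- ∣ S ∣ ≤ ∣ W ∣ has U and V ─ U both nonempty, and take ∣ W ∣ as large as possible.
-- If Z ⊆ U is stable, so is Z ∪ (S ─ U), hence ∣ Z ∣ ≤ ∣ S ∩ U ∣; if Z ⊆ V ─ U is
-- stable, then Z together with the part of W inside U is semistable, and ∣ Z ∣ is at
-- most the size of W ─ U ⊆ S.  So S is maximum on both parts, and BE-path partitions
-- of the two parts join up.  The hypothesis ∣ V ∣ ≤ 2 α is what makes ∣ W ∣ maximal
-- also against the excluded semistable sets S and V ─ S.
--
-- If there is no such W, choose an edge between s ∈ S and t ∉ S.  A stable set
-- avoiding s and t is semistable, hence smaller than S, so S ─ ⁅ s ⁆ is maximum in
-- D ─ ⁅ s ⁆ ─ ⁅ t ⁆ and the edge can be split off as a path.  Without such an edge,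
-- V = S and a single vertex can be split off.
module Submission where

open import Defs
open import Data.Fin using (Fin; zero; suc)
open import Data.Fin.Properties using (all?; any?)
open import Data.Fin.Subset
  using (Subset; inside; outside; _∈_; _∉_; _⊆_; _⊂_; _∩_; _∪_; _─_; ⋃; ⁅_⁆; ∣_∣; Nonempty)
open import Data.Fin.Subset.Properties
open import Data.List using (List; []; _∷_; _++_; map; length; lookup)
open import Data.List.Membership.Propositional.Properties using (∈-lookup)
open import Data.List.NonEmpty using (_∷_; toList)
open import Data.List.Relation.Unary.All as All using (All; []; _∷_)
import Data.List.Relation.Unary.All.Properties as All
open import Data.List.Relation.Unary.AllPairs using ([]; _∷_)
open import Data.List.Relation.Unary.Any using (Any; here)
import Data.List.Relation.Unary.Any.Properties as Any
open import Data.List.Relation.Unary.Linked as Linked using ([-]; _∷_)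
open import Data.Nat using (ℕ; zero; suc; _+_; _*_; _≤_; _<_; _≤?_; _<?_)
open import Data.Nat.Properties
open import Data.Product using (∃; ∃!; _×_; _,_; proj₁; proj₂)
open import Data.Sum using (_⊎_; inj₁; inj₂; [_,_]′; swap)
open import Data.Vec using ([]; _∷_; here; there)
open import Function using (_∘_; case_of_)
open import Relation.Binary.PropositionalEquality
  using (_≡_; refl; sym; trans; cong; subst)
open import Relation.Nullary using (¬_; yes; no; contradiction; ¬?)
open import Relation.Nullary.Decidable using (_×-dec_; _→-dec_)
open import Relation.Unary using (Decidable)

private variable
  N : ℕ
  A B : Set

-- Differences and cardinalities of finite sets.

x∈p─q⇒x∉q : ∀ {x} (p q : Subset N) → x ∈ p ─ q → x ∉ q
x∈p─q⇒x∉q (inside  ∷ p) (outside ∷ q) here          ()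
x∈p─q⇒x∉q (_       ∷ p) (_       ∷ q) (there x∈p─q) (there x∈q) = x∈p─q⇒x∉q p q x∈p─q x∈q

∣p∣≡∣p∩q∣+∣p─q∣ : (p q : Subset N) → ∣ p ∣ ≡ ∣ p ∩ q ∣ + ∣ p ─ q ∣
∣p∣≡∣p∩q∣+∣p─q∣ []            []            = refl
∣p∣≡∣p∩q∣+∣p─q∣ (inside  ∷ p) (inside  ∷ q) = cong suc (∣p∣≡∣p∩q∣+∣p─q∣ p q)
∣p∣≡∣p∩q∣+∣p─q∣ (inside  ∷ p) (outside ∷ q) =
  trans (cong suc (∣p∣≡∣p∩q∣+∣p─q∣ p q)) (sym (+-suc _ _))
∣p∣≡∣p∩q∣+∣p─q∣ (outside ∷ p) (inside  ∷ q) = ∣p∣≡∣p∩q∣+∣p─q∣ p q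
∣p∣≡∣p∩q∣+∣p─q∣ (outside ∷ p) (outside ∷ q) = ∣p∣≡∣p∩q∣+∣p─q∣ p q

-- Both unions are split along `U`: `Z` takes the place of `R ∩ U` while `R ─ U` is kept, so a union
-- no larger than `R` leaves `Z` no room to exceed what it replaced. It is used with `R` equal to
-- `S` and to `W`.
exchange : ∀ {Z U R : Subset N} → Z ⊆ U → ∣ Z ∪ (R ─ U) ∣ ≤ ∣ R ∣ → ∣ Z ∣ ≤ ∣ R ∩ U ∣
exchange {Z = Z} {U} {R} Z⊆U ∣Y∣≤∣R∣ = +-cancelʳ-≤ _ _ _ (begin
  ∣ Z ∣ + ∣ R ─ U ∣          ≤⟨ +-mono-≤ (p⊆q⇒∣p∣≤∣q∣ Z⊆Y∩U) (p⊆q⇒∣p∣≤∣q∣ R─U⊆Y─U) ⟩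
  ∣ Y ∩ U ∣ + ∣ Y ─ U ∣      ≡⟨ ∣p∣≡∣p∩q∣+∣p─q∣ Y U ⟨
  ∣ Y ∣                      ≤⟨ ∣Y∣≤∣R∣ ⟩
  ∣ R ∣                      ≡⟨ ∣p∣≡∣p∩q∣+∣p─q∣ R U ⟩
  ∣ R ∩ U ∣ + ∣ R ─ U ∣      ∎)
  where
  open ≤-Reasoning
  Y = Z ∪ (R ─ U)

  Z⊆Y∩U : Z ⊆ Y ∩ U
  Z⊆Y∩U z∈Z = x∈p∩q⁺ (x∈p∪q⁺ (inj₁ z∈Z) , Z⊆U z∈Z)

  R─U⊆Y─U : R ─ U ⊆ Y ─ U
  R─U⊆Y─U x∈ = x∈p∧x∉q⇒x∈p─q (x∈p∪q⁺ (inj₂ x∈)) (x∈p─q⇒x∉q R U x∈)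

-- Sets of largest size with a decidable property.

module _ {P : Subset N → Set} (P? : Decidable P) where

  Largest : Subset N → Set
  Largest W = P W × (∀ W′ → P W′ → ∣ W′ ∣ ≤ ∣ W ∣)

  ∃-largest : ∃ P → ∃ Largest
  ∃-largest (W₀ , P-W₀) = go N W₀ P-W₀ (m≤n+m N ∣ W₀ ∣)
    where
    -- `k` bounds the remaining enlargements: each adds at least one element, and at `k = 0` the set
    -- `W` already has the greatest possible size `N`.
    go : ∀ k W → P W → N ≤ ∣ W ∣ + k → ∃ Largest
    go zero W P-W N≤ = W , P-W , λ W′ _ →
      ≤-trans (∣p∣≤n W′) (subst (N ≤_) (+-identityʳ ∣ W ∣) N≤)
    go (suc k) W P-W N≤ with anySubset? (λ W′ → P? W′ ×-dec (∣ W ∣ <? ∣ W′ ∣))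
    ... | yes (W′ , P-W′ , W<W′) = go k W′ P-W′
          (≤-trans N≤ (≤-trans (≤-reflexive (+-suc ∣ W ∣ k)) (+-monoˡ-≤ k W<W′)))
    ... | no  ∄larger = W , P-W , λ W′ P-W′ → ≮⇒≥ (λ W<W′ → ∄larger (W′ , P-W′ , W<W′))

-- An inductive form of the unique index in PathPartition, stable under _++_ and map.

data One (P : A → Set) : List A → Set where
  here  : ∀ {x xs} → P x → All (¬_ ∘ P) xs → One P (x ∷ xs)
  there : ∀ {x xs} → ¬ P x → One P xs → One P (x ∷ xs)

module _ {P : A → Set} where

  ∃!⇒One : ∀ xs → ∃! _≡_ (λ (i : Fin (length xs)) → P (lookup xs i)) → One P xs
  ∃!⇒One (x ∷ xs) (zero  , px , unique) = here px (none xs (λ i p → case unique {suc i} p of λ ()))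
    where
    none : ∀ xs → (∀ i → ¬ P (lookup xs i)) → All (¬_ ∘ P) xs
    none []       _  = []
    none (x ∷ xs) ¬p = ¬p zero ∷ none xs (¬p ∘ suc)
  ∃!⇒One (x ∷ xs) (suc i , pi , unique) =
    there (λ px → case unique {zero} px of λ ())
          (∃!⇒One xs (i , pi , λ {j} pj → case unique {suc j} pj of λ { refl → refl }))

  One⇒∃! : ∀ {xs} → One P xs → ∃! _≡_ (λ (i : Fin (length xs)) → P (lookup xs i))
  One⇒∃! (here {x} {xs} px ¬pxs) = zero , px , λ {i} → first i
    where
    first : ∀ i → P (lookup (x ∷ xs) i) → zero ≡ i
    first zero    _  = refl
    first (suc j) pj = contradiction pj (All.lookup ¬pxs (∈-lookup j))
  One⇒∃! (there {x} {xs} ¬px one) with i , pi , unique ← One⇒∃! one =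
    suc i , pi , λ {j} → later j
    where
    later : ∀ j → P (lookup (x ∷ xs) j) → suc i ≡ j
    later zero    px = contradiction px ¬px
    later (suc j) pj = cong suc (unique pj)

  One-++ˡ : ∀ {xs ys} → One P xs → All (¬_ ∘ P) ys → One P (xs ++ ys)
  One-++ˡ (here px ¬pxs) ¬pys = here px (All.++⁺ ¬pxs ¬pys)
  One-++ˡ (there ¬px o)  ¬pys = there ¬px (One-++ˡ o ¬pys)

  One-++ʳ : ∀ {xs ys} → All (¬_ ∘ P) xs → One P ys → One P (xs ++ ys)
  One-++ʳ []           o = o
  One-++ʳ (¬px ∷ ¬pxs) o = there ¬px (One-++ʳ ¬pxs o)

  One-map⁺ : {f : B → A} → ∀ {xs} → One (P ∘ f) xs → One P (map f xs)
  One-map⁺ (here px ¬pxs) = here px (All.map⁺ ¬pxs)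
  One-map⁺ (there ¬px o)  = there ¬px (One-map⁺ o)

-- Path systems on a part of the vertex set.

open Path

∈⋃⁅⁆⇒ : ∀ {Q : Fin N → Set} {v} xs → All Q xs → v ∈ ⋃ (map ⁅_⁆ xs) → Q v
∈⋃⁅⁆⇒ []       _         v∈ = contradiction v∈ ∉⊥
∈⋃⁅⁆⇒ (x ∷ xs) (qx ∷ qs) v∈ with x∈p∪q⁻ ⁅ x ⁆ _ v∈
... | inj₂ v∈xs = ∈⋃⁅⁆⇒ xs qs v∈xs
... | inj₁ v∈x with refl ← x∈⁅y⁆⇒x≡y x v∈x = qx

vertexSet⊆V : {D : Digraph N} (P : Path D) → vertexSet P ⊆ V D
vertexSet⊆V P = ∈⋃⁅⁆⇒ (toList (vertices P)) (inV P)

module _ (D : Digraph N) (S : Subset N) where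

  -- The paths are paths of `D` rather than of an induced subdigraph, so that the lists for two
  -- complementary parts can be concatenated.
  record Covers (U : Subset N) (𝒫 : List (Path D)) : Set where
    field
      within     : All (λ P → vertexSet P ⊆ U) 𝒫
      once       : ∀ v → v ∈ U → One (λ P → v ∈ vertexSet P) 𝒫
      orthogonal : Orthogonal D S 𝒫
      endpoints  : ∀ v → v ∈ S → v ∈ U → Any (λ P → start P ≡ v ⊎ end P ≡ v) 𝒫

  open Covers

  module _ (S⊆V : S ⊆ V D) where

    -- By `within`, a vertex of one part lies on no path of the other part, so uniqueness survives
    -- concatenation.
    join : ∀ {U 𝒫 𝒬} → Covers U 𝒫 → Covers (V D ─ U) 𝒬 → BEPathPartition D S (𝒫 ++ 𝒬)
    join {U} {𝒫} {𝒬} 𝒫-covers 𝒬-covers =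
        (λ v v∈V → One⇒∃! (one v v∈V))
      , All.++⁺ (orthogonal 𝒫-covers) (orthogonal 𝒬-covers)
      , ends
      where
      one : ∀ v → v ∈ V D → One (λ P → v ∈ vertexSet P) (𝒫 ++ 𝒬)
      one v v∈V with v ∈? U
      ... | yes v∈U = One-++ˡ (once 𝒫-covers v v∈U)
            (All.map (λ Q⊆ v∈Q → x∈p─q⇒x∉q (V D) U (Q⊆ v∈Q) v∈U) (within 𝒬-covers))
      ... | no  v∉U = One-++ʳ (All.map (λ P⊆U v∈P → v∉U (P⊆U v∈P)) (within 𝒫-covers))
            (once 𝒬-covers v (x∈p∧x∉q⇒x∈p─q v∈V v∉U))

      ends : ∀ v → v ∈ S → Any (λ P → start P ≡ v ⊎ end P ≡ v) (𝒫 ++ 𝒬)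
      ends v v∈S with v ∈? U
      ... | yes v∈U = Any.++⁺ˡ (endpoints 𝒫-covers v v∈S v∈U)
      ... | no  v∉U =
            Any.++⁺ʳ 𝒫 (endpoints 𝒬-covers v v∈S (x∈p∧x∉q⇒x∈p─q (S⊆V v∈S) v∉U))

  module _ {U : Subset N} (U⊆V : U ⊆ V D) where

    extend : Path (induced D U U⊆V) → Path D
    extend P = record
      { vertices = vertices P
      ; inV      = All.map U⊆V (inV P)
      ; distinct = distinct P
      ; linked   = Linked.map proj₁ (linked P)
      }

    induced-covers : ∀ {𝒫} → BEPathPartition (induced D U U⊆V) (S ∩ U) 𝒫 →
                     Covers U (map extend 𝒫)
    induced-covers {𝒫} (partition , orth , ends) = record
      { within     = All.map⁺ (All.universal {P = λ P → vertexSet P ⊆ U} (λ P → vertexSet⊆V P) 𝒫)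
      ; once       = λ v v∈U → One-map⁺ (∃!⇒One 𝒫 (partition v v∈U))
      ; orthogonal = All.map⁺ (All.map (λ {P} → trans (cong ∣_∣ (trace P))) orth)
      ; endpoints  = λ v v∈S v∈U → Any.map⁺ (ends v (x∈p∩q⁺ (v∈S , v∈U)))
      }
      where
      -- Paths of the induced subdigraph stay inside `U`, so orthogonality to `S ∩ U` amounts to
      -- orthogonality to `S`.
      trace : (P : Path (induced D U U⊆V)) → vertexSet P ∩ S ≡ vertexSet P ∩ (S ∩ U)
      trace P = ⊆-antisym
        (λ x∈ → let x∈P , x∈S = x∈p∩q⁻ (vertexSet P) S x∈ in
                x∈p∩q⁺ (x∈P , x∈p∩q⁺ (x∈S , vertexSet⊆V P x∈P)))
        (λ x∈ → let x∈P , x∈S∩U = x∈p∩q⁻ (vertexSet P) (S ∩ U) x∈ in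
                x∈p∩q⁺ (x∈P , p∩q⊆p S U x∈S∩U))

  path-covers : (P : Path D) → ∣ vertexSet P ∩ S ∣ ≡ 1 →
                (∀ v → v ∈ S → v ∈ vertexSet P → start P ≡ v ⊎ end P ≡ v) →
                Covers (vertexSet P) (P ∷ [])
  path-covers P ∣P∩S∣≡1 ends = record
    { within     = (λ v∈P → v∈P) ∷ []
    ; once       = λ v v∈P → here v∈P []
    ; orthogonal = ∣P∩S∣≡1 ∷ []
    ; endpoints  = λ v v∈S v∈P → here (ends v v∈S v∈P)
    }

-- Stable sets in a digraph and in its induced subdigraphs.

module _ (D : Digraph N) where

  Stable-∪ : ∀ {A B} → Stable D A → Stable D B →
             (∀ u v → u ∈ A → v ∈ B → ¬ Adjacent D u v) → Stable D (A ∪ B)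
  Stable-∪ {A} {B} (A⊆V , A-stable) (B⊆V , B-stable) cross =
      (λ x∈ → [ (λ x∈A → A⊆V x∈A) , (λ x∈B → B⊆V x∈B) ]′ (x∈p∪q⁻ A B x∈))
    , λ u v u∈ v∈ → case (x∈p∪q⁻ A B u∈ , x∈p∪q⁻ A B v∈) of λ where
        (inj₁ u∈A , inj₁ v∈A) → A-stable u v u∈A v∈A
        (inj₁ u∈A , inj₂ v∈B) → cross u v u∈A v∈B
        (inj₂ u∈B , inj₁ v∈A) → cross v u v∈A u∈B ∘ swap
        (inj₂ u∈B , inj₂ v∈B) → B-stable u v u∈B v∈B

  Stable-⁅⁆ : ∀ {v} → v ∈ V D → Stable D ⁅ v ⁆
  Stable-⁅⁆ {v} v∈V =
      (λ x∈ → subst (_∈ V D) (sym (x∈⁅y⁆⇒x≡y v x∈)) v∈V)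
    , λ x y x∈ y∈ → let x≡y = trans (x∈⁅y⁆⇒x≡y v x∈) (sym (x∈⁅y⁆⇒x≡y v y∈)) in
        [ irrefl D x≡y , irrefl D (sym x≡y) ]′

  Stable-⊆ : ∀ {A B} → A ⊆ B → Stable D B → Stable D A
  Stable-⊆ A⊆B (B⊆V , B-stable) =
    (λ x∈A → B⊆V (A⊆B x∈A)) , λ u v u∈A v∈A → B-stable u v (A⊆B u∈A) (A⊆B v∈A)

  module _ {U : Subset N} (U⊆V : U ⊆ V D) where

    Stable-induced⁺ : ∀ {Z} → Z ⊆ U → Stable D Z → Stable (induced D U U⊆V) Z
    Stable-induced⁺ Z⊆U (_ , Z-stable) =
      Z⊆U , λ u v u∈Z v∈Z → λ where
        (inj₁ uv) → Z-stable u v u∈Z v∈Z (inj₁ (proj₁ uv))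
        (inj₂ vu) → Z-stable u v u∈Z v∈Z (inj₂ (proj₁ vu))

    Stable-induced⁻ : ∀ {Z} → Stable (induced D U U⊆V) Z → Stable D Z
    Stable-induced⁻ (Z⊆U , Z-stable) =
      (λ z∈Z → U⊆V (Z⊆U z∈Z)) , λ u v u∈Z v∈Z → λ where
        (inj₁ uv) → Z-stable u v u∈Z v∈Z (inj₁ (uv , Z⊆U u∈Z , Z⊆U v∈Z))
        (inj₂ vu) → Z-stable u v u∈Z v∈Z (inj₂ (vu , Z⊆U v∈Z , Z⊆U u∈Z))

    -- It suffices to apply the bound to one stable set attaining `α` of the induced subdigraph. The
    -- bound speaks of stability in `D`, so later arguments can stay in `D`.
    MaximumStable-induced : ∀ {S} → Stable D S →
      (∀ Z → Z ⊆ U → Stable D Z → ∣ Z ∣ ≤ ∣ S ∩ U ∣) →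
      MaximumStable (induced D U U⊆V) (S ∩ U)
    MaximumStable-induced {S} S-stable bound =
        S∩U-stable
      , ≤-antisym (∣stable∣≤α (induced D U U⊆V) (S ∩ U) S∩U-stable)
          (let Z , Z-stable , ∣Z∣≡α = α-attained (induced D U U⊆V) in
           subst (_≤ ∣ S ∩ U ∣) ∣Z∣≡α (bound Z (proj₁ Z-stable) (Stable-induced⁻ Z-stable)))
      where
      S∩U-stable : Stable (induced D U U⊆V) (S ∩ U)
      S∩U-stable = Stable-induced⁺ (p∩q⊆q S U) (Stable-⊆ (p∩q⊆p S U) S-stable)

-- A fixed maximum stable set and the induction hypothesis.

module _ (D : Digraph N)
  (ih : ∀ (U : Subset N) (U⊂V : U ⊂ V D) → BEProperty (induced D U (proj₁ U⊂V)))
  (small : ∣ V D ∣ ≤ 2 * α D)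
  (S : Subset N) (S-max : MaximumStable D S)
  where

  private
    S-stable = proj₁ S-max

    S⊆V : S ⊆ V D
    S⊆V = proj₁ S-stable

    ∣stable∣≤∣S∣ : ∀ Z → Stable D Z → ∣ Z ∣ ≤ ∣ S ∣
    ∣stable∣≤∣S∣ Z Z-stable = subst (∣ Z ∣ ≤_) (sym (proj₂ S-max)) (∣stable∣≤α D Z Z-stable)

    -- This is the form in which the hypothesis on `α` enters: since `∣ S ∣ ≡ α D`, the set `S`
    -- fills at least half of `V D`.
    ∣V─S∣≤∣S∣ : ∣ V D ─ S ∣ ≤ ∣ S ∣
    ∣V─S∣≤∣S∣ = +-cancelˡ-≤ _ _ _ (begin
      ∣ S ∣ + ∣ V D ─ S ∣        ≤⟨ +-monoˡ-≤ _ (p⊆q⇒∣p∣≤∣q∣ S⊆V∩S) ⟩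
      ∣ V D ∩ S ∣ + ∣ V D ─ S ∣  ≡⟨ ∣p∣≡∣p∩q∣+∣p─q∣ (V D) S ⟨
      ∣ V D ∣                    ≤⟨ small ⟩
      2 * α D                    ≡⟨ cong (2 *_) (proj₂ S-max) ⟨
      ∣ S ∣ + (∣ S ∣ + 0)        ≡⟨ cong (∣ S ∣ +_) (+-identityʳ ∣ S ∣) ⟩
      ∣ S ∣ + ∣ S ∣              ∎)
      where
      open ≤-Reasoning
      S⊆V∩S : S ⊆ V D ∩ S
      S⊆V∩S x∈S = x∈p∩q⁺ (S⊆V x∈S , x∈S)

    part-covers : ∀ {U} (U⊂V : U ⊂ V D) →
      (∀ Z → Z ⊆ U → Stable D Z → ∣ Z ∣ ≤ ∣ S ∩ U ∣) → ∃ (Covers D S U)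
    part-covers {U} U⊂V bound =
      let 𝒫 , be = ih U U⊂V (S ∩ U) (MaximumStable-induced D (proj₁ U⊂V) S-stable bound)
      in _ , induced-covers D S (proj₁ U⊂V) be

    V─U⊂V : ∀ {U v} → v ∈ U → v ∈ V D → V D ─ U ⊂ V D
    V─U⊂V {U} {v} v∈U v∈V = p─q⊆p (V D) U , v , v∈V , λ v∈ → x∈p─q⇒x∉q (V D) U v∈ v∈U

  -- `P` serves as one path of the partition, and the induction hypothesis handles its complement.
  -- The strict bound makes the rest of `S` maximum there, because only `s` is lost.
  split-path : ∀ (P : Path D) {s} → s ∈ S → s ∈ vertexSet P →
    All (λ v → v ∈ S → v ≡ s) (toList (vertices P)) → start P ≡ s ⊎ end P ≡ s →
    (∀ Z → Z ⊆ V D ─ vertexSet P → Stable D Z → ∣ Z ∣ < ∣ S ∣) →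
    ∃ (BEPathPartition D S)
  split-path P {s} s∈S s∈P all-s s-end bound =
    let 𝒬 , 𝒬-covers = part-covers (V─U⊂V start∈P (vertexSet⊆V P start∈P)) bound′
    in _ , join D S S⊆V (path-covers D S P ∣P∩S∣≡1 ends) 𝒬-covers
    where
    open ≤-Reasoning hiding (start)
    Q = V D ─ vertexSet P

    only-s : ∀ {v} → v ∈ vertexSet P → v ∈ S → v ≡ s
    only-s = ∈⋃⁅⁆⇒ (toList (vertices P)) all-s

    ∣P∩S∣≡1 : ∣ vertexSet P ∩ S ∣ ≡ 1
    ∣P∩S∣≡1 = trans (cong ∣_∣ P∩S≡⁅s⁆) (∣⁅x⁆∣≡1 s)
      where
      P∩S≡⁅s⁆ : vertexSet P ∩ S ≡ ⁅ s ⁆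
      P∩S≡⁅s⁆ = ⊆-antisym
        (λ v∈ → let v∈P , v∈S = x∈p∩q⁻ (vertexSet P) S v∈ in
                subst (_∈ ⁅ s ⁆) (sym (only-s v∈P v∈S)) (x∈⁅x⁆ s))
        (λ v∈ → subst (_∈ vertexSet P ∩ S) (sym (x∈⁅y⁆⇒x≡y s v∈)) (x∈p∩q⁺ (s∈P , s∈S)))

    ends : ∀ v → v ∈ S → v ∈ vertexSet P → start P ≡ v ⊎ end P ≡ v
    ends v v∈S v∈P = subst (λ w → start P ≡ w ⊎ end P ≡ w) (sym (only-s v∈P v∈S)) s-end

    start∈P : start P ∈ vertexSet P
    start∈P = x∈p∪q⁺ (inj₁ (x∈⁅x⁆ (start P)))

    S─Q⊆P∩S : S ─ Q ⊆ vertexSet P ∩ S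
    S─Q⊆P∩S {x} x∈ with x ∈? vertexSet P
    ... | yes x∈P = x∈p∩q⁺ (x∈P , p─q⊆p S Q x∈)
    ... | no  x∉P = contradiction (x∈p∧x∉q⇒x∈p─q (S⊆V (p─q⊆p S Q x∈)) x∉P) (x∈p─q⇒x∉q S Q x∈)

    bound′ : ∀ Z → Z ⊆ Q → Stable D Z → ∣ Z ∣ ≤ ∣ S ∩ Q ∣
    -- The 1 gained from the strict inequality pays for `s`, the one vertex of `S` outside `Q`.
    bound′ Z Z⊆Q Z-stable = +-cancelʳ-≤ 1 _ _ (begin
      ∣ Z ∣ + 1                          ≡⟨ +-comm ∣ Z ∣ 1 ⟩
      suc ∣ Z ∣                          ≤⟨ bound Z Z⊆Q Z-stable ⟩
      ∣ S ∣                              ≡⟨ ∣p∣≡∣p∩q∣+∣p─q∣ S Q ⟩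
      ∣ S ∩ Q ∣ + ∣ S ─ Q ∣              ≤⟨ +-monoʳ-≤ ∣ S ∩ Q ∣ (p⊆q⇒∣p∣≤∣q∣ S─Q⊆P∩S) ⟩
      ∣ S ∩ Q ∣ + ∣ vertexSet P ∩ S ∣    ≡⟨ cong (∣ S ∩ Q ∣ +_) ∣P∩S∣≡1 ⟩
      ∣ S ∩ Q ∣ + 1                      ∎)

  -- Splitting along a semistable set.

  Semistable : Subset N → Set
  Semistable W = W ⊆ V D ×
    (∀ u v → u ∈ W → v ∈ W → u ∈ S → v ∉ S → ¬ Adjacent D u v)

  semistable? : Decidable Semistable
  semistable? W = (W ⊆? V D) ×-dec
    all? (λ u → all? (λ v → (u ∈? W) →-dec ((v ∈? W) →-dec
      ((u ∈? S) →-dec (¬? (v ∈? S) →-dec ¬? (adjacent? D u v))))))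

  _△S : Subset N → Subset N
  W △S = (W ─ S) ∪ (S ─ W)

  -- For `W ⊆ V D`, the two `Nonempty` conditions exclude exactly `W = S` and `W = V D ─ S`. They
  -- make both parts proper subsets of `V D`, as the induction hypothesis requires.
  Splitting : Subset N → Set
  Splitting W = Semistable W × Nonempty (W △S) × Nonempty (V D ─ W △S) × ∣ S ∣ ≤ ∣ W ∣

  splitting? : Decidable Splitting
  splitting? W =
    semistable? W ×-dec nonempty? (W △S) ×-dec nonempty? (V D ─ W △S) ×-dec (∣ S ∣ ≤? ∣ W ∣)

  split-semistable : ∃ (Largest splitting?) → ∃ (BEPathPartition D S)
  split-semistable (W , ((W⊆V , W-semi) , (x , x∈U) , (y , y∈Q) , S≤W) , W-largest) =
    let 𝒫 , 𝒫-covers = part-covers U⊂V U-bound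
        𝒬 , 𝒬-covers = part-covers (V─U⊂V x∈U (U⊆V x∈U)) Q-bound
    in _ , join D S S⊆V 𝒫-covers 𝒬-covers
    where
    U = W △S
    Q = V D ─ U

    U⊆V : U ⊆ V D
    U⊆V v∈U = [ (λ v∈ → W⊆V (p─q⊆p W S v∈)) , (λ v∈ → S⊆V (p─q⊆p S W v∈)) ]′
                (x∈p∪q⁻ (W ─ S) (S ─ W) v∈U)

    U⊂V : U ⊂ V D
    U⊂V = U⊆V , y , p─q⊆p (V D) U y∈Q , x∈p─q⇒x∉q (V D) U y∈Q

    -- Off the symmetric difference `U`, the sets `S` and `W` agree; this inclusion and the next are
    -- the two halves.
    S─U⊆W : ∀ {v} → v ∈ S → v ∉ U → v ∈ W
    S─U⊆W {v} v∈S v∉U with v ∈? W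
    ... | yes v∈W = v∈W
    ... | no  v∉W = contradiction (x∈p∪q⁺ (inj₂ (x∈p∧x∉q⇒x∈p─q v∈S v∉W))) v∉U

    W─U⊆S : ∀ {v} → v ∈ W → v ∉ U → v ∈ S
    W─U⊆S {v} v∈W v∉U with v ∈? S
    ... | yes v∈S = v∈S
    ... | no  v∉S = contradiction (x∈p∪q⁺ (inj₁ (x∈p∧x∉q⇒x∈p─q v∈W v∉S))) v∉U

    ∉Q⇒∈U : ∀ {v} → v ∈ V D → v ∉ Q → v ∈ U
    ∉Q⇒∈U {v} v∈V v∉Q with v ∈? U
    ... | yes v∈U = v∈U
    ... | no  v∉U = contradiction (x∈p∧x∉q⇒x∈p─q v∈V v∉U) v∉Q

    U-bound : ∀ Z → Z ⊆ U → Stable D Z → ∣ Z ∣ ≤ ∣ S ∩ U ∣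
    U-bound Z Z⊆U Z-stable = exchange Z⊆U (∣stable∣≤∣S∣ _
      (Stable-∪ D Z-stable (Stable-⊆ D (p─q⊆p S U) S-stable) cross))
      where
      cross : ∀ u v → u ∈ Z → v ∈ S ─ U → ¬ Adjacent D u v
      -- If `u ∈ S ─ W`, stability of `S` applies. If `u ∈ W ─ S`, semistability of `W` applies,
      -- since `v ∈ S ─ U` lies in `W`.
      cross u v u∈Z v∈S─U with v∈S ← p─q⊆p S U v∈S─U | x∈p∪q⁻ (W ─ S) (S ─ W) (Z⊆U u∈Z)
      ... | inj₂ u∈S─W = proj₂ S-stable u v (p─q⊆p S W u∈S─W) v∈S
      ... | inj₁ u∈W─S =
            W-semi v u (S─U⊆W v∈S (x∈p─q⇒x∉q S U v∈S─U)) (p─q⊆p W S u∈W─S)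
                   v∈S (x∈p─q⇒x∉q W S u∈W─S) ∘ swap

    -- A `Y` that is not splitting is smaller than `S`, or contained in `S`, or contained in
    -- `V D ─ S`; in each case its size is at most `∣ S ∣`, hence at most `∣ W ∣`.
    ∣semistable∣≤∣W∣ : ∀ Y → Semistable Y → ∣ Y ∣ ≤ ∣ W ∣
    ∣semistable∣≤∣W∣ Y Y-semi with nonempty? (Y △S) | nonempty? (V D ─ Y △S) | ∣ S ∣ ≤? ∣ Y ∣
    ... | yes ne | yes ne′ | yes S≤Y = W-largest Y (Y-semi , ne , ne′ , S≤Y)
    ... | _      | _       | no  S≰Y = ≤-trans (<⇒≤ (≰⇒> S≰Y)) S≤W
    ... | no  em | _       | _       = ≤-trans (p⊆q⇒∣p∣≤∣q∣ Y⊆S) S≤W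
      where
      Y⊆S : Y ⊆ S
      Y⊆S {v} v∈Y with v ∈? S
      ... | yes v∈S = v∈S
      ... | no  v∉S = contradiction (v , x∈p∪q⁺ (inj₁ (x∈p∧x∉q⇒x∈p─q v∈Y v∉S))) em
    ... | _      | no em   | _       = ≤-trans (p⊆q⇒∣p∣≤∣q∣ Y⊆V─S) (≤-trans ∣V─S∣≤∣S∣ S≤W)
      where
      Y⊆V─S : Y ⊆ V D ─ S
      Y⊆V─S {v} v∈Y = x∈p∧x∉q⇒x∈p─q v∈V λ v∈S →
        em (v , x∈p∧x∉q⇒x∈p─q v∈V λ v∈△ →
          [ (λ v∈Y─S → x∈p─q⇒x∉q Y S v∈Y─S v∈S) , (λ v∈S─Y → x∈p─q⇒x∉q S Y v∈S─Y v∈Y) ]′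
            (x∈p∪q⁻ (Y ─ S) (S ─ Y) v∈△))
        where v∈V = proj₁ Y-semi v∈Y

    -- Here semistability is needed in place of stability: `W ─ Q` is the part of `W` outside `S`,
    -- and edges inside it are harmless.
    Q-bound : ∀ Z → Z ⊆ Q → Stable D Z → ∣ Z ∣ ≤ ∣ S ∩ Q ∣
    Q-bound Z Z⊆Q (Z⊆V , Z-stable) =
      ≤-trans (exchange Z⊆Q (∣semistable∣≤∣W∣ Y (Y⊆V , Y-semi))) (p⊆q⇒∣p∣≤∣q∣ W∩Q⊆S∩Q)
      where
      Y = Z ∪ (W ─ Q)

      Y⊆V : Y ⊆ V D
      Y⊆V v∈Y = [ (λ v∈Z → Z⊆V v∈Z) , (λ v∈ → W⊆V (p─q⊆p W Q v∈)) ]′ (x∈p∪q⁻ Z (W ─ Q) v∈Y)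

      Y-semi : ∀ u v → u ∈ Y → v ∈ Y → u ∈ S → v ∉ S → ¬ Adjacent D u v
      Y-semi u v u∈Y v∈Y u∈S v∉S with x∈p∪q⁻ Z (W ─ Q) u∈Y | x∈p∪q⁻ Z (W ─ Q) v∈Y
      ... | inj₁ u∈Z | inj₁ v∈Z = Z-stable u v u∈Z v∈Z
      -- `u` lies in `S` and off `U`, hence in `W`, so the pair is already governed by `W`.
      ... | inj₁ u∈Z | inj₂ v∈  =
            W-semi u v (S─U⊆W u∈S (x∈p─q⇒x∉q (V D) U (Z⊆Q u∈Z))) (p─q⊆p W Q v∈) u∈S v∉S
      -- This case is void: a vertex of `W` in `U` is not in `S`.
      ... | inj₂ u∈  | _ with x∈p∪q⁻ (W ─ S) (S ─ W) (∉Q⇒∈U (S⊆V u∈S) (x∈p─q⇒x∉q W Q u∈))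
      ...   | inj₁ u∈W─S = contradiction u∈S (x∈p─q⇒x∉q W S u∈W─S)
      ...   | inj₂ u∈S─W = contradiction (p─q⊆p W Q u∈) (x∈p─q⇒x∉q S W u∈S─W)

      W∩Q⊆S∩Q : W ∩ Q ⊆ S ∩ Q
      W∩Q⊆S∩Q v∈ = let v∈W , v∈Q = x∈p∩q⁻ W Q v∈ in
        x∈p∩q⁺ (W─U⊆S v∈W (x∈p─q⇒x∉q (V D) U v∈Q) , v∈Q)

  -- Splitting off an edge or a single vertex.

  split-edge : ¬ ∃ Splitting → ∀ {s t} → s ∈ S → t ∉ S → Adjacent D s t →
               ∃ (BEPathPartition D S)
  split-edge ∄splitting {s} {t} s∈S t∉S = λ where
      (inj₁ st) → split-path
        (record { vertices = s ∷ t ∷ []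
                ; inV      = proj₁ (edge∈V D st) ∷ proj₂ (edge∈V D st) ∷ []
                ; distinct = (s≢t ∷ []) ∷ [] ∷ []
                ; linked   = st ∷ [-] })
        s∈S first
        ((λ _ → refl) ∷ (λ t∈S → contradiction t∈S t∉S) ∷ [])
        (inj₁ refl)
        (λ Z Z⊆ → bound (proj₂ (edge∈V D st)) (avoids Z⊆ first) (avoids Z⊆ second))
      (inj₂ ts) → split-path
        (record { vertices = t ∷ s ∷ []
                ; inV      = proj₁ (edge∈V D ts) ∷ proj₂ (edge∈V D ts) ∷ []
                ; distinct = ((s≢t ∘ sym) ∷ []) ∷ [] ∷ []
                ; linked   = ts ∷ [-] })
        s∈S second
        ((λ t∈S → contradiction t∈S t∉S) ∷ (λ _ → refl) ∷ [])
        (inj₂ refl)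
        (λ Z Z⊆ → bound (proj₁ (edge∈V D ts)) (avoids Z⊆ second) (avoids Z⊆ first))
    where
    s≢t : ¬ s ≡ t
    s≢t refl = t∉S s∈S

    first : ∀ {x y : Fin N} → x ∈ ⋃ (map ⁅_⁆ (x ∷ y ∷ []))
    first {x} = x∈p∪q⁺ (inj₁ (x∈⁅x⁆ x))

    second : ∀ {x y : Fin N} → y ∈ ⋃ (map ⁅_⁆ (x ∷ y ∷ []))
    second {y = y} = x∈p∪q⁺ (inj₂ (x∈p∪q⁺ (inj₁ (x∈⁅x⁆ y))))

    avoids : ∀ {Z p v} → Z ⊆ V D ─ p → v ∈ p → v ∉ Z
    avoids {p = p} Z⊆ v∈p v∈Z = x∈p─q⇒x∉q (V D) p (Z⊆ v∈Z) v∈p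

    bound : ∀ {Z} → t ∈ V D → s ∉ Z → t ∉ Z → Stable D Z → ∣ Z ∣ < ∣ S ∣
    -- Were `Z` as large as `S`, it would be splitting: `s` lies in `S ─ Z`, and `t`, being in
    -- neither set, lies off the symmetric difference.
    bound {Z} t∈V s∉Z t∉Z (Z⊆V , Z-stable) = ≰⇒> λ S≤Z → ∄splitting
      ( Z
      , (Z⊆V , λ u v u∈Z v∈Z _ _ → Z-stable u v u∈Z v∈Z)
      , (s , x∈p∪q⁺ (inj₂ (x∈p∧x∉q⇒x∈p─q s∈S s∉Z)))
      , (t , x∈p∧x∉q⇒x∈p─q t∈V λ t∈△ →
          [ (λ t∈ → t∉Z (p─q⊆p Z S t∈)) , (λ t∈ → t∉S (p─q⊆p S Z t∈)) ]′
            (x∈p∪q⁻ (Z ─ S) (S ─ Z) t∈△))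
      , S≤Z )

  split-isolated : V D ⊆ S → ∃ (BEPathPartition D S)
  split-isolated V⊆S with nonempty? S
  ... | no  empty     = [] , (λ v v∈V → contradiction (v , V⊆S v∈V) empty)
                           , [] , λ v v∈S → contradiction (v , v∈S) empty
  ... | yes (s , s∈S) = split-path
    (record { vertices = s ∷ [] ; inV = S⊆V s∈S ∷ [] ; distinct = [] ∷ [] ; linked = [-] })
    s∈S s∈P ((λ _ → refl) ∷ []) (inj₁ refl)
    -- With every vertex in `S`, a set avoiding `s` is a proper subset of `S`, whence the strict
    -- bound.
    (λ Z Z⊆ Z-stable → p⊂q⇒∣p∣<∣q∣
      ((λ z∈Z → V⊆S (proj₁ Z-stable z∈Z)) , s , s∈S ,
       λ s∈Z → x∈p─q⇒x∉q (V D) _ (Z⊆ s∈Z) s∈P))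
    where
    s∈P : s ∈ ⋃ (map ⁅_⁆ (s ∷ []))
    s∈P = x∈p∪q⁺ (inj₁ (x∈⁅x⁆ s))

  -- A vertex outside `S` with no neighbour in `S` could be added to `S`, against maximality.
  V⊆S : ¬ (∃ λ s → ∃ λ t → s ∈ S × t ∉ S × Adjacent D s t) → V D ⊆ S
  V⊆S ∄edge {v} v∈V with v ∈? S
  ... | yes v∈S = v∈S
  ... | no  v∉S = contradiction (∣stable∣≤∣S∣ (S ∪ ⁅ v ⁆) S∪v-stable) (<⇒≱ (p⊂q⇒∣p∣<∣q∣ S⊂S∪v))
    where
    S∪v-stable : Stable D (S ∪ ⁅ v ⁆)
    S∪v-stable = Stable-∪ D S-stable (Stable-⁅⁆ D v∈V) λ u w u∈S w∈v uw →
      ∄edge (u , v , u∈S , v∉S , subst (Adjacent D u) (x∈⁅y⁆⇒x≡y v w∈v) uw)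

    S⊂S∪v : S ⊂ S ∪ ⁅ v ⁆
    S⊂S∪v = p⊆p∪q ⁅ v ⁆ , v , x∈p∪q⁺ (inj₂ (x∈⁅x⁆ v)) , v∉S

  ∃-BEPathPartition : ∃ (BEPathPartition D S)
  ∃-BEPathPartition with anySubset? splitting?
  ... | yes splitting  = split-semistable (∃-largest splitting? splitting)
  ... | no  ∄splitting
    with any? (λ s → any? (λ t → (s ∈? S) ×-dec ¬? (t ∈? S) ×-dec adjacent? D s t))
  ...   | yes (s , t , s∈S , t∉S , st) = split-edge ∄splitting s∈S t∉S st
  ...   | no  ∄edge                    = split-isolated (V⊆S ∄edge)

theorem14 : ∀ {N : ℕ} (D : Digraph N) →
    (∀ (U : Subset N) (U⊂V : U ⊂ V D) → BEProperty (induced D U (proj₁ U⊂V))) →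
    ∣ V D ∣ ≤ 2 * α D →
    BEProperty D
theorem14 D ih small S S-max = ∃-BEPathPartition D ih small S S-max
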